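{- For all integers $m,n>0$ and all integers $0\le a\le n-1$, $0\le b\le a$, $$d(-m;n,1,a,b)=(-1)^{n-1-a}\,p(m;n,1,a,b).$$
   Context: For integers $m$ (possibly negative) and $n,t,a,b$ put $$d(m;n,t,a,b)=\binom{n-b-2}{a-b}\binom{mn-t+1}{n-t-a}-m\binom{n-b-1}{a-b}\binom{mn-t}{n-t-a-1},$$ $$p(m;n,t,a,b)=\left(\frac{t+a}{n}-\frac{a-b}{n-b-1}\right)\binom{n-b-1}{a-b}\binom{mn+n-t-a-1}{n-t-a}.$$ Binomial coefficients are polynomials in the upper argument: $\binom{z}{k}=z(z-1)\cdots(z-k+1)/k!$ for $k\ge0$ and $\binom{z}{k}=0$ for $k<0$; the fraction $\frac{a-b}{n-b-1}$ is read as $0$ when $a=b=n-1$. For $m>0$, $d(m;n,1,a,b)$ is the number of $(m,1)$-Dyck paths of height $n$ with exactly $a$ valleys whose $x$-coordinate is divisible by $m$ and exactly $b$ returns, and $p(m;n,1,a,b)$ is the number of positive $(m,1)$-Schröder paths of height $n$ all of whose diagonal steps end at $x$-coordinates divisible by $m$, with exactly $a$ diagonal steps and $b$ diagonal steps of the form $(im-1,i)\to(im,i+1)$. Here an $(m,1)$-Dyck path (resp. $(m,1)$-Schröder path) of height $n$ is a lattice path from $(0,0)$ to $(mn,n)$ with steps $(0,1),(1,0)$ (resp. $(0,1),(1,0),(1,1)$) starting with a step $(0,1)$ and never going below $x=my$; a valley is a point preceded by a step $(1,0)$ and followed by a step $(0,1)$; a return is a valley of the form $(mi,i)$; and positive means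 touching $x=my$ only at the two endpoints. -}

module Defs where

open import Data.Nat.Base using (ℕ; zero; suc; _!)
open import Data.Nat.Properties using (_!≢0)
open import Data.Integer.Base using (ℤ; +_; -[1+_]; +[1+_]; 1ℤ; _+_; _-_; _*_; -_)
open import Data.Rational.Base as ℚ using (ℚ; 0ℚ)

fromℤ : ℤ → ℚ
fromℤ i = i ℚ./ 1

falling : ℤ → ℕ → ℤ
falling z zero    = 1ℤ
falling z (suc k) = falling z k * (z - + k)

binom : ℤ → ℤ → ℚ
binom z (+ k)    = (falling z k ℚ./ (k !)) {{k !≢0}}
binom z -[1+ _ ] = 0ℚ

infixl 7 _÷_

-- The quotient i / j, read as 0 when j = 0.  In p below, with n > 0 and
-- 0 ≤ b ≤ a ≤ n - 1, a zero denominator occurs only as n - b - 1 = 0, which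
-- forces a = b = n - 1: the case in which (a - b)/(n - b - 1) is read as 0.
_÷_ : ℤ → ℤ → ℚ
i ÷ (+ zero)   = 0ℚ
i ÷ +[1+ j ]   = i ℚ./ suc j
i ÷ -[1+ j ]   = (- i) ℚ./ suc j

d : (m n t a b : ℤ) → ℚ
d m n t a b =
  binom (n - b - + 2) (a - b) ℚ.* binom (m * n - t + 1ℤ) (n - t - a)
    ℚ.- fromℤ m ℚ.* binom (n - b - 1ℤ) (a - b) ℚ.* binom (m * n - t) (n - t - a - 1ℤ)

p : (m n t a b : ℤ) → ℚ
p m n t a b =
  ((t + a) ÷ n ℚ.- (a - b) ÷ (n - b - 1ℤ))
    ℚ.* binom (n - b - 1ℤ) (a - b)
    ℚ.* binom (m * n + n - t - a - 1ℤ) (n - t - a)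

{-# OPTIONS --safe #-}
-- Write c = a - b, K = n - 1 - a and M = n - b - 1 = c + K.  The identities
--   binom (M - 1) c = (1 - c / M) binom M c,
--   m binom (m n - 1) (K - 1) = (K / n) binom (m n) K
-- turn d (m; n, 1, a, b) into (1 - c / M - K / n) binom M c binom (m n) K, with
-- 1 - K / n = (1 + a) / n; replacing m by -m, the reflection
-- binom (- z) K = (-1)^K binom (z + K - 1) K turns this into p.
module Submission where

open import Data.Nat.Base using (ℕ; _≤_; _>_; _∸_; zero; suc; _!)
import Data.Nat.Base as ℕ
import Data.Nat.Properties as ℕ
open import Data.Integer.Base using (+_; -[1+_]; +[1+_]; -_; 1ℤ; -1ℤ; 0ℤ; _^_)
import Data.Integer.Base as ℤ
import Data.Integer.Properties as ℤ
open import Data.Integer.Tactic.RingSolver using (solve-∀)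
open import Data.Rational.Base using (1ℚ; _*_; _+_; _-_; _/_; fromℚᵘ)
import Data.Rational.Base as ℚ
import Data.Rational.Properties as ℚ
open import Data.Rational.Solver using (module +-*-Solver)
open import Data.Rational.Unnormalised.Base as ℚᵘ using (mkℚᵘ; *≡*)
import Data.Rational.Unnormalised.Properties as ℚᵘ
open import Relation.Binary.PropositionalEquality
  using (_≡_; refl; sym; trans; cong; cong₂; module ≡-Reasoning)
open import Defs
open ≡-Reasoning

-- Arithmetic of `fromℤ` and of the quotient `÷`.

-- `fromℤ i` and `i / suc n` are by definition `fromℚᵘ` of an unnormalised fraction, so this and its
-- additive analogue move computations to fractions that need no reduction to lowest terms.
fromℚᵘ-homo-* : ∀ x y → fromℚᵘ (x ℚᵘ.* y) ≡ fromℚᵘ x * fromℚᵘ y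
fromℚᵘ-homo-* x y = ℚ.toℚᵘ-injective (ℚᵘ.≃-trans (ℚ.toℚᵘ-fromℚᵘ (x ℚᵘ.* y))
  (ℚᵘ.≃-sym (ℚᵘ.≃-trans (ℚ.toℚᵘ-homo-* (fromℚᵘ x) (fromℚᵘ y))
    (ℚᵘ.*-cong (ℚ.toℚᵘ-fromℚᵘ x) (ℚ.toℚᵘ-fromℚᵘ y)))))

fromℚᵘ-homo-+ : ∀ x y → fromℚᵘ (x ℚᵘ.+ y) ≡ fromℚᵘ x + fromℚᵘ y
fromℚᵘ-homo-+ x y = ℚ.toℚᵘ-injective (ℚᵘ.≃-trans (ℚ.toℚᵘ-fromℚᵘ (x ℚᵘ.+ y))
  (ℚᵘ.≃-sym (ℚᵘ.≃-trans (ℚ.toℚᵘ-homo-+ (fromℚᵘ x) (fromℚᵘ y))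
    (ℚᵘ.+-cong (ℚ.toℚᵘ-fromℚᵘ x) (ℚ.toℚᵘ-fromℚᵘ y)))))

fromℤ-* : ∀ i j → fromℤ (i ℤ.* j) ≡ fromℤ i * fromℤ j
fromℤ-* i j = fromℚᵘ-homo-* (mkℚᵘ i 0) (mkℚᵘ j 0)

fromℤ-+ : ∀ i j → fromℤ (i ℤ.+ j) ≡ fromℤ i + fromℤ j
fromℤ-+ i j = trans
  -- The unnormalised sum of i/1 and j/1 has numerator `i * 1 + j * 1`.
  (cong fromℤ (sym (cong₂ ℤ._+_ (ℤ.*-identityʳ i) (ℤ.*-identityʳ j))))
  (fromℚᵘ-homo-+ (mkℚᵘ i 0) (mkℚᵘ j 0))

fromℤ-neg : ∀ i → fromℤ (- i) ≡ ℚ.- fromℤ i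
fromℤ-neg i = begin
  fromℤ (- i)                        ≡⟨ cong fromℤ (sym (ℤ.-1*i≡-i i)) ⟩
  fromℤ (-1ℤ ℤ.* i)                  ≡⟨ fromℤ-* -1ℤ i ⟩
  fromℤ -1ℤ * fromℤ i                ≡⟨ sym (ℚ.neg-distribˡ-* 1ℚ (fromℤ i)) ⟩
  ℚ.- (1ℚ * fromℤ i)                 ≡⟨ cong ℚ.-_ (ℚ.*-identityˡ (fromℤ i)) ⟩
  ℚ.- fromℤ i                        ∎

fromℤ-minus : ∀ i j → fromℤ (i ℤ.- j) ≡ fromℤ i - fromℤ j
fromℤ-minus i j = trans (fromℤ-+ i (- j)) (cong (_+_ (fromℤ i)) (fromℤ-neg j))

n*[i/n]≡i : ∀ i n .{{_ : ℕ.NonZero n}} → fromℤ (+ n) * (i / n) ≡ fromℤ i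
n*[i/n]≡i i (suc n) = trans (sym (fromℚᵘ-homo-* (mkℚᵘ (+ suc n) 0) (mkℚᵘ i n)))
  (ℚ.fromℚᵘ-cong {mkℚᵘ (+ suc n) 0 ℚᵘ.* mkℚᵘ i n} {mkℚᵘ i 0} (*≡* eq))
  where
  -- Cross-multiplied form; `suc (n + 0)` is the product `1 * suc n` of the denominators, as it
  -- computes.
  eq : + suc n ℤ.* i ℤ.* 1ℤ ≡ i ℤ.* + suc (n ℕ.+ 0)
  eq rewrite ℕ.+-identityʳ n = trans (ℤ.*-identityʳ _) (ℤ.*-comm (+ suc n) i)

j*[i÷j]≡i : ∀ i j .{{_ : ℤ.NonZero j}} → fromℤ j * (i ÷ j) ≡ fromℤ i
j*[i÷j]≡i i +[1+ j ] = n*[i/n]≡i i (suc j)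
j*[i÷j]≡i i -[1+ j ] = begin
  fromℤ (- +[1+ j ]) * x             ≡⟨ cong (_* x) (fromℤ-neg +[1+ j ]) ⟩
  ℚ.- fromℤ +[1+ j ] * x             ≡⟨ sym (ℚ.neg-distribˡ-* (fromℤ +[1+ j ]) x) ⟩
  ℚ.- (fromℤ +[1+ j ] * x)           ≡⟨ cong ℚ.-_ (n*[i/n]≡i (- i) (suc j)) ⟩
  ℚ.- fromℤ (- i)                    ≡⟨ sym (fromℤ-neg (- i)) ⟩
  fromℤ (- - i)                      ≡⟨ cong fromℤ (ℤ.neg-involutive i) ⟩
  fromℤ i                            ∎
  where
  x = (- i) / suc j

-- `1ℤ ÷ i` is an inverse of `fromℤ i`. The identities for quotients and binomials below are proved
-- by clearing a denominator and then cancelling it this way.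
fromℤ-*-cancelˡ : ∀ i .{{_ : ℤ.NonZero i}} {x y} → fromℤ i * x ≡ fromℤ i * y → x ≡ y
fromℤ-*-cancelˡ i {x} {y} eq = begin
  x                          ≡⟨ insert x ⟩
  1ℤ ÷ i * (fromℤ i * x)     ≡⟨ cong (1ℤ ÷ i *_) eq ⟩
  1ℤ ÷ i * (fromℤ i * y)     ≡⟨ sym (insert y) ⟩
  y                          ∎
  where
  insert : ∀ z → z ≡ 1ℤ ÷ i * (fromℤ i * z)
  insert z = begin
    z                        ≡⟨ sym (ℚ.*-identityˡ z) ⟩
    1ℚ * z                   ≡⟨ cong (_* z) (sym (j*[i÷j]≡i 1ℤ i)) ⟩
    fromℤ i * (1ℤ ÷ i) * z   ≡⟨ cong (_* z) (ℚ.*-comm (fromℤ i) (1ℤ ÷ i)) ⟩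
    1ℤ ÷ i * fromℤ i * z     ≡⟨ ℚ.*-assoc (1ℤ ÷ i) (fromℤ i) z ⟩
    1ℤ ÷ i * (fromℤ i * z)   ∎

÷-+ : ∀ i j k .{{_ : ℤ.NonZero k}} → (i ℤ.+ j) ÷ k ≡ i ÷ k + j ÷ k
÷-+ i j k = fromℤ-*-cancelˡ k (begin
  fromℤ k * ((i ℤ.+ j) ÷ k)                 ≡⟨ j*[i÷j]≡i (i ℤ.+ j) k ⟩
  fromℤ (i ℤ.+ j)                           ≡⟨ fromℤ-+ i j ⟩
  fromℤ i + fromℤ j                         ≡⟨ sym (cong₂ _+_ (j*[i÷j]≡i i k) (j*[i÷j]≡i j k)) ⟩
  fromℤ k * (i ÷ k) + fromℤ k * (j ÷ k)     ≡⟨ sym (ℚ.*-distribˡ-+ (fromℤ k) (i ÷ k) (j ÷ k)) ⟩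
  fromℤ k * (i ÷ k + j ÷ k)                 ∎)

i÷i≡1 : ∀ i .{{_ : ℤ.NonZero i}} → i ÷ i ≡ 1ℚ
i÷i≡1 i = fromℤ-*-cancelˡ i (trans (j*[i÷j]≡i i i) (sym (ℚ.*-identityʳ (fromℤ i))))

-- Falling factorials.

-- `falling` splits off its last factor by definition; the absorption identities and the reflection
-- also need the first factor split off.
falling-suc : ∀ z k → falling z (suc k) ≡ z ℤ.* falling (z ℤ.- 1ℤ) k
falling-suc z zero    = base z
  where
  base : ∀ z → 1ℤ ℤ.* (z ℤ.- 0ℤ) ≡ z ℤ.* 1ℤ
  base = solve-∀
falling-suc z (suc k) = trans (cong (ℤ._* (z ℤ.- + suc k)) (falling-suc z k))
  (step z (falling (z ℤ.- 1ℤ) k) (+ k))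
  where
  step : ∀ z f k → z ℤ.* f ℤ.* (z ℤ.- (1ℤ ℤ.+ k)) ≡ z ℤ.* (f ℤ.* (z ℤ.- 1ℤ ℤ.- k))
  step = solve-∀

-- Each factor `- z - j` is -1 times `z + j`, and z (z + 1) ... (z + k - 1) read from the top is a
-- falling factorial. The factor added in the induction step becomes the new top one, hence
-- `falling-suc`.
falling-neg : ∀ z k → falling (- z) k ≡ -1ℤ ^ k ℤ.* falling (z ℤ.+ + k ℤ.- 1ℤ) k
falling-neg z zero    = refl
falling-neg z (suc k) = begin
  falling (- z) k ℤ.* (- z ℤ.- + k)
    ≡⟨ cong (ℤ._* (- z ℤ.- + k)) (falling-neg z k) ⟩
  -1ℤ ^ k ℤ.* falling (z ℤ.+ + k ℤ.- 1ℤ) k ℤ.* (- z ℤ.- + k)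
    ≡⟨ regroup (-1ℤ ^ k) (falling (z ℤ.+ + k ℤ.- 1ℤ) k) z (+ k) ⟩
  -1ℤ ℤ.* -1ℤ ^ k ℤ.* ((z ℤ.+ + k) ℤ.* falling (z ℤ.+ + k ℤ.- 1ℤ) k)
    ≡⟨ cong (-1ℤ ℤ.* -1ℤ ^ k ℤ.*_) (sym (falling-suc (z ℤ.+ + k) k)) ⟩
  -1ℤ ℤ.* -1ℤ ^ k ℤ.* falling (z ℤ.+ + k) (suc k)
    ≡⟨ cong (λ y → -1ℤ ℤ.* -1ℤ ^ k ℤ.* falling y (suc k)) (shift z (+ k)) ⟩
  -1ℤ ℤ.* -1ℤ ^ k ℤ.* falling (z ℤ.+ + suc k ℤ.- 1ℤ) (suc k)
    ∎
  where
  regroup : ∀ s f z k → s ℤ.* f ℤ.* (- z ℤ.- k) ≡ -1ℤ ℤ.* s ℤ.* ((z ℤ.+ k) ℤ.* f)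
  regroup = solve-∀
  shift : ∀ z k → z ℤ.+ k ≡ z ℤ.+ (1ℤ ℤ.+ k) ℤ.- 1ℤ
  shift = solve-∀

-- Binomial coefficients with integer upper argument.

k!*binom : ∀ z k → fromℤ (+ (k !)) * binom z (+ k) ≡ fromℤ (falling z k)
k!*binom z k = n*[i/n]≡i (falling z k) (k !) {{k ℕ.!≢0}}

-- Together with `k!-cancel`, this reduces linear identities between binomials to integer identities
-- between falling factorials.
k!*scaled-binom : ∀ i z k → fromℤ (+ (k !)) * (fromℤ i * binom z (+ k)) ≡ fromℤ (i ℤ.* falling z k)
k!*scaled-binom i z k = begin
  fromℤ (+ (k !)) * (fromℤ i * binom z (+ k))
    ≡⟨ swap (fromℤ (+ (k !))) (fromℤ i) (binom z (+ k)) ⟩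
  fromℤ i * (fromℤ (+ (k !)) * binom z (+ k))
    ≡⟨ cong (fromℤ i *_) (k!*binom z k) ⟩
  fromℤ i * fromℤ (falling z k)
    ≡⟨ sym (fromℤ-* i (falling z k)) ⟩
  fromℤ (i ℤ.* falling z k)
    ∎
  where
  open +-*-Solver
  swap : ∀ x y z → x * (y * z) ≡ y * (x * z)
  swap = solve 3 (λ x y z → x :* (y :* z) := y :* (x :* z)) refl

k!-cancel : ∀ k {x y} → fromℤ (+ (k !)) * x ≡ fromℤ (+ (k !)) * y → x ≡ y
k!-cancel k = fromℤ-*-cancelˡ (+ (k !)) {{k ℕ.!≢0}}

binom-neg : ∀ z k → binom (- z) (+ k) ≡ fromℤ (-1ℤ ^ k) * binom (z ℤ.+ + k ℤ.- 1ℤ) (+ k)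
binom-neg z k = k!-cancel k (begin
  fromℤ (+ (k !)) * binom (- z) (+ k)                ≡⟨ k!*binom (- z) k ⟩
  fromℤ (falling (- z) k)                            ≡⟨ cong fromℤ (falling-neg z k) ⟩
  fromℤ (-1ℤ ^ k ℤ.* falling (z ℤ.+ + k ℤ.- 1ℤ) k)   ≡⟨ sym (k!*scaled-binom (-1ℤ ^ k) _ k) ⟩
  fromℤ (+ (k !)) * (fromℤ (-1ℤ ^ k) * binom (z ℤ.+ + k ℤ.- 1ℤ) (+ k)) ∎)

-- After multiplication by `k !` both sides are `falling z (suc k)`, with the first factor split off
-- on the left and the last one on the right.
upper-absorption : ∀ z k → fromℤ z * binom (z ℤ.- 1ℤ) (+ k) ≡ fromℤ (z ℤ.- + k) * binom z (+ k)
upper-absorption z k = k!-cancel k (begin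
  fromℤ (+ (k !)) * (fromℤ z * binom (z ℤ.- 1ℤ) (+ k))  ≡⟨ k!*scaled-binom z (z ℤ.- 1ℤ) k ⟩
  fromℤ (z ℤ.* falling (z ℤ.- 1ℤ) k)                    ≡⟨ cong fromℤ (sym (falling-suc z k)) ⟩
  fromℤ (falling z k ℤ.* (z ℤ.- + k))                   ≡⟨ cong fromℤ (ℤ.*-comm (falling z k) (z ℤ.- + k)) ⟩
  fromℤ ((z ℤ.- + k) ℤ.* falling z k)                   ≡⟨ sym (k!*scaled-binom (z ℤ.- + k) z k) ⟩
  fromℤ (+ (k !)) * (fromℤ (z ℤ.- + k) * binom z (+ k)) ∎)

lower-absorption : ∀ z k → fromℤ (+ k) * binom z (+ k) ≡ fromℤ z * binom (z ℤ.- 1ℤ) (+ k ℤ.- 1ℤ)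
-- The lower index on the right is -1, where `binom` is 0 by definition.
lower-absorption z zero    = trans (ℚ.*-zeroˡ (binom z 0ℤ)) (sym (ℚ.*-zeroʳ (fromℤ z)))
-- Only `k !` is cancelled: the factor `suc k` on the left completes it to `suc k !`.
lower-absorption z (suc k) = k!-cancel k (begin
  fromℤ (+ (k !)) * (fromℤ (+ suc k) * binom z (+ suc k))
    ≡⟨ sym (ℚ.*-assoc (fromℤ (+ (k !))) (fromℤ (+ suc k)) (binom z (+ suc k))) ⟩
  fromℤ (+ (k !)) * fromℤ (+ suc k) * binom z (+ suc k)
    ≡⟨ cong (_* binom z (+ suc k)) (sym (fromℤ-* (+ (k !)) (+ suc k))) ⟩
  fromℤ (+ (k !) ℤ.* + suc k) * binom z (+ suc k)
    ≡⟨ cong (λ y → fromℤ y * binom z (+ suc k)) factorial-suc ⟩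
  fromℤ (+ (suc k !)) * binom z (+ suc k)
    ≡⟨ k!*binom z (suc k) ⟩
  fromℤ (falling z (suc k))
    ≡⟨ cong fromℤ (falling-suc z k) ⟩
  fromℤ (z ℤ.* falling (z ℤ.- 1ℤ) k)
    ≡⟨ sym (k!*scaled-binom z (z ℤ.- 1ℤ) k) ⟩
  fromℤ (+ (k !)) * (fromℤ z * binom (z ℤ.- 1ℤ) (+ k))
    ∎)
  where
  factorial-suc : + (k !) ℤ.* + suc k ≡ + (suc k !)
  factorial-suc = trans (ℤ.*-comm (+ (k !)) (+ suc k)) (sym (ℤ.pos-* (suc k) (k !)))

-- k ≤ n rules out n = 0 < k, where the junk value k ÷ 0 = 0 falsifies the identity.
binom-pred-upper : ∀ n k → k ≤ n →
  binom (+ n ℤ.- 1ℤ) (+ k) ≡ (1ℚ - + k ÷ + n) * binom (+ n) (+ k)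
binom-pred-upper zero    .zero ℕ.z≤n = refl
binom-pred-upper (suc n) k     _     = fromℤ-*-cancelˡ z (begin
  fromℤ z * binom (z ℤ.- 1ℤ) (+ k)           ≡⟨ upper-absorption z k ⟩
  fromℤ (z ℤ.- + k) * B                      ≡⟨ cong (_* B) (fromℤ-minus z (+ k)) ⟩
  (fromℤ z - fromℤ (+ k)) * B                ≡⟨ cong (λ y → (fromℤ z - y) * B) (sym (j*[i÷j]≡i (+ k) z)) ⟩
  (fromℤ z - fromℤ z * (+ k ÷ z)) * B        ≡⟨ factor (fromℤ z) (+ k ÷ z) B ⟩
  fromℤ z * ((1ℚ - + k ÷ z) * B)             ∎)
  where
  z = + suc n
  B = binom z (+ k)
  open +-*-Solver
  factor : ∀ x y b → (x - x * y) * b ≡ x * ((1ℚ - y) * b)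
  factor = solve 3 (λ x y b → (x :- x :* y) :* b := x :* ((con 1ℚ :- y) :* b)) refl

-- This is `lower-absorption` at `m * n`. Only n is divided out, so m may be any integer, in
-- particular the negative one substituted later.
binom-pred-both : ∀ m n k .{{_ : ℤ.NonZero n}} →
  fromℤ m * binom (m ℤ.* n ℤ.- 1ℤ) (+ k ℤ.- 1ℤ) ≡ + k ÷ n * binom (m ℤ.* n) (+ k)
binom-pred-both m n k = fromℤ-*-cancelˡ n (begin
  fromℤ n * (fromℤ m * V)          ≡⟨ sym (ℚ.*-assoc (fromℤ n) (fromℤ m) V) ⟩
  fromℤ n * fromℤ m * V            ≡⟨ cong (_* V) (ℚ.*-comm (fromℤ n) (fromℤ m)) ⟩
  fromℤ m * fromℤ n * V            ≡⟨ cong (_* V) (sym (fromℤ-* m n)) ⟩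
  fromℤ (m ℤ.* n) * V              ≡⟨ sym (lower-absorption (m ℤ.* n) k) ⟩
  fromℤ (+ k) * W                  ≡⟨ cong (_* W) (sym (j*[i÷j]≡i (+ k) n)) ⟩
  fromℤ n * (+ k ÷ n) * W          ≡⟨ ℚ.*-assoc (fromℤ n) (+ k ÷ n) W ⟩
  fromℤ n * (+ k ÷ n * W)          ∎)
  where
  V = binom (m ℤ.* n ℤ.- 1ℤ) (+ k ℤ.- 1ℤ)
  W = binom (m ℤ.* n) (+ k)

-- Factorisation of `d` and comparison with `p`.

-- The order conditions enter as the naturals c and k, which put the lower indices in the
-- nonnegative branch of `binom`. On the right, m occurs only in the last binomial, so a change of
-- sign of m affects nothing else.
d-factored : ∀ m n a b .{{_ : ℤ.NonZero n}} c k →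
  a ℤ.- b ≡ + c → n ℤ.- 1ℤ ℤ.- a ≡ + k →
  d m n 1ℤ a b ≡
    ((1ℤ ℤ.+ a) ÷ n - (a ℤ.- b) ÷ (n ℤ.- b ℤ.- 1ℤ))
      * binom (n ℤ.- b ℤ.- 1ℤ) (a ℤ.- b) * binom (m ℤ.* n) (+ k)
d-factored m n a b c k a-b≡c n-1-a≡k = begin
  d m n 1ℤ a b
    ≡⟨ cong₂ _-_
         (cong₂ _*_ (cong₂ binom (trans (pred-M n b) (cong (ℤ._- 1ℤ) M≡c+k)) a-b≡c)
                    (cong₂ binom (cancel-one (m ℤ.* n)) n-1-a≡k))
         (cong₂ (λ x v → fromℤ m * x * v)
                (cong₂ binom M≡c+k a-b≡c)
                (cong (λ j → binom (m ℤ.* n ℤ.- 1ℤ) (j ℤ.- 1ℤ)) n-1-a≡k)) ⟩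
  binom (+ M ℤ.- 1ℤ) (+ c) * W - fromℤ m * X * V
    -- The required bound is c ≤ c + k. If M = 0, then c = 0 and the default `0 ÷ 0 = 0` makes both
    -- sides 1, which is the convention for a = b = n - 1.
    ≡⟨ cong (λ y → y * W - fromℤ m * X * V) (binom-pred-upper M c (ℕ.m≤m+n c k)) ⟩
  (1ℚ - β) * X * W - fromℤ m * X * V
    ≡⟨ regroup β X W (fromℤ m) V ⟩
  (1ℚ - β) * X * W - X * (fromℤ m * V)
    -- Writing 1 as `α + κ` lets the `κ` part cancel the second term of `d`.
    ≡⟨ cong₂ (λ u v → (u - β) * X * W - X * v) one≡α+κ (binom-pred-both m n k) ⟩
  (α + κ - β) * X * W - X * (κ * W)
    ≡⟨ collect α κ β X W ⟩
  (α - β) * X * W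
    ≡⟨ cong₂ (λ N j → (α - j ÷ N) * binom N j * W) (sym M≡c+k) (sym a-b≡c) ⟩
  (α - (a ℤ.- b) ÷ (n ℤ.- b ℤ.- 1ℤ)) * binom (n ℤ.- b ℤ.- 1ℤ) (a ℤ.- b) * W
    ∎
  where
  M = c ℕ.+ k
  X = binom (+ M) (+ c)
  W = binom (m ℤ.* n) (+ k)
  V = binom (m ℤ.* n ℤ.- 1ℤ) (+ k ℤ.- 1ℤ)
  α = (1ℤ ℤ.+ a) ÷ n
  β = + c ÷ + M
  κ = + k ÷ n
  pred-M : ∀ n b → n ℤ.- b ℤ.- + 2 ≡ n ℤ.- b ℤ.- 1ℤ ℤ.- 1ℤ
  pred-M = solve-∀
  cancel-one : ∀ z → z ℤ.- 1ℤ ℤ.+ 1ℤ ≡ z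
  cancel-one = solve-∀
  split-M : ∀ n a b → n ℤ.- b ℤ.- 1ℤ ≡ (a ℤ.- b) ℤ.+ (n ℤ.- 1ℤ ℤ.- a)
  split-M = solve-∀
  split-n : ∀ n a → n ≡ (1ℤ ℤ.+ a) ℤ.+ (n ℤ.- 1ℤ ℤ.- a)
  split-n = solve-∀
  M≡c+k : n ℤ.- b ℤ.- 1ℤ ≡ + M
  M≡c+k = trans (split-M n a b) (cong₂ ℤ._+_ a-b≡c n-1-a≡k)
  one≡α+κ : 1ℚ ≡ α + κ
  one≡α+κ = begin
    1ℚ                           ≡⟨ sym (i÷i≡1 n) ⟩
    n ÷ n                        ≡⟨ cong (_÷ n) (trans (split-n n a) (cong (λ j → 1ℤ ℤ.+ a ℤ.+ j) n-1-a≡k)) ⟩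
    (1ℤ ℤ.+ a ℤ.+ + k) ÷ n       ≡⟨ ÷-+ (1ℤ ℤ.+ a) (+ k) n ⟩
    α + κ                        ∎
  open +-*-Solver
  regroup : ∀ β x w m v → (1ℚ - β) * x * w - m * x * v ≡ (1ℚ - β) * x * w - x * (m * v)
  regroup = solve 5 (λ β x w m v →
    (con 1ℚ :- β) :* x :* w :- m :* x :* v := (con 1ℚ :- β) :* x :* w :- x :* (m :* v)) refl
  collect : ∀ α κ β x w → (α + κ - β) * x * w - x * (κ * w) ≡ (α - β) * x * w
  collect = solve 5 (λ α κ β x w →
    (α :+ κ :- β) :* x :* w :- x :* (κ :* w) := (α :- β) :* x :* w) refl

reciprocity : ∀ m n a b .{{_ : ℤ.NonZero n}} c k →
  a ℤ.- b ≡ + c → n ℤ.- 1ℤ ℤ.- a ≡ + k →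
  d (- m) n 1ℤ a b ≡ fromℤ (-1ℤ ^ k) * p m n 1ℤ a b
reciprocity m n a b c k a-b≡c n-1-a≡k = begin
  d (- m) n 1ℤ a b
    ≡⟨ d-factored (- m) n a b c k a-b≡c n-1-a≡k ⟩
  Q * binom (- m ℤ.* n) (+ k)
    ≡⟨ cong (λ z → Q * binom z (+ k)) (sym (ℤ.neg-distribˡ-* m n)) ⟩
  Q * binom (- (m ℤ.* n)) (+ k)
    ≡⟨ cong (Q *_) (binom-neg (m ℤ.* n) k) ⟩
  Q * (s * binom (m ℤ.* n ℤ.+ + k ℤ.- 1ℤ) (+ k))
    -- The reflected upper argument `m * n + k - 1` is that of `p` once k is read as `n - 1 - a`
    -- again.
    ≡⟨ cong (λ j → Q * (s * binom (m ℤ.* n ℤ.+ j ℤ.- 1ℤ) j)) (sym n-1-a≡k) ⟩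
  Q * (s * binom (m ℤ.* n ℤ.+ (n ℤ.- 1ℤ ℤ.- a) ℤ.- 1ℤ) (n ℤ.- 1ℤ ℤ.- a))
    ≡⟨ cong (λ z → Q * (s * binom z (n ℤ.- 1ℤ ℤ.- a))) (reassoc (m ℤ.* n) n a) ⟩
  Q * (s * binom (m ℤ.* n ℤ.+ n ℤ.- 1ℤ ℤ.- a ℤ.- 1ℤ) (n ℤ.- 1ℤ ℤ.- a))
    -- `Q` times the remaining binomial is `p m n 1ℤ a b` by unfolding.
    ≡⟨ swap Q s _ ⟩
  s * p m n 1ℤ a b
    ∎
  where
  s = fromℤ (-1ℤ ^ k)
  Q = ((1ℤ ℤ.+ a) ÷ n - (a ℤ.- b) ÷ (n ℤ.- b ℤ.- 1ℤ)) * binom (n ℤ.- b ℤ.- 1ℤ) (a ℤ.- b)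
  reassoc : ∀ z n a → z ℤ.+ (n ℤ.- 1ℤ ℤ.- a) ℤ.- 1ℤ ≡ z ℤ.+ n ℤ.- 1ℤ ℤ.- a ℤ.- 1ℤ
  reassoc = solve-∀
  open +-*-Solver
  swap : ∀ x y z → x * (y * z) ≡ y * (x * z)
  swap = solve 3 (λ x y z → x :* (y :* z) := y :* (x :* z)) refl

theorem4p1 : (m n : ℕ) → m > 0 → n > 0 → (a b : ℕ) → a ≤ n ∸ 1 → b ≤ a →
    d (- (+ m)) (+ n) 1ℤ (+ a) (+ b) ≡ fromℤ (-1ℤ ^ (n ∸ 1 ∸ a)) * p (+ m) (+ n) 1ℤ (+ a) (+ b)
theorem4p1 m (suc n) _ _ a b a≤n b≤a =
  -- With n in successor form, `+ suc n - 1ℤ` computes to `+ n`, and the exponent `suc n ∸ 1 ∸ a` to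
  -- `n ∸ a`.
  reciprocity (+ m) (+ suc n) (+ a) (+ b) (a ∸ b) (n ∸ a) (pos-∸ b≤a) (pos-∸ a≤n)
  where
  -- Truncated and integer subtraction agree only under the order hypothesis; this is where `b ≤ a`
  -- and `a ≤ n ∸ 1` enter.
  pos-∸ : ∀ {i j} → j ≤ i → + i ℤ.- + j ≡ + (i ∸ j)
  pos-∸ {i} {j} j≤i = trans (ℤ.m-n≡m⊖n i j) (ℤ.⊖-≥ j≤i)
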